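{- Let $k\ge 1$ be an integer and let $(P_{k,n})_{n\ge0}$ be the generalized $k$-Pell-Tribonacci sequence. For every integer $n\geq 0$, $$\sum_{i=0}^{n}iP_{k,i}=\frac{(a_1n+a_2)P_{k,n+3}+(b_1n+b_2)P_{k,n+2}+(c_1n+c_2)P_{k,n+1}+d}{9k^2},$$ where $a_1=3k$, $a_2=5k-3$, $b_1=3k-6k^2$, $b_2=-10k^2+8k-3$, $c_1=3k-9k^2$, $c_2=-9k^2+8k-3$, and $d=k+3$.
   Context: For an integer $k\geq 1$, the generalized $k$-Pell-Tribonacci sequence $(P_{k,n})_{n\ge 0}$ is defined by $P_{k,0}=0$, $P_{k,1}=1$, $P_{k,2}=2k$ and $P_{k,n}=2kP_{k,n-1}+kP_{k,n-2}+P_{k,n-3}$ for $n\geq 3$. -}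

module Defs where

open import Data.Nat using (ℕ; suc; _+_; _*_; _^_; NonZero)
open import Data.Nat.Properties using (m*n≢0; m^n≢0)

-- The generalized k-Pell-Tribonacci sequence; P k n stands for P_{k,n}.
P : ℕ → ℕ → ℕ
P k 0 = 0
P k 1 = 1
P k 2 = 2 * k
P k (suc (suc (suc n))) = 2 * k * P k (suc (suc n)) + k * P k (suc n) + P k n

9*k^2≢0 : ∀ k → .{{_ : NonZero k}} → NonZero (9 * k ^ 2)
9*k^2≢0 k = m*n≢0 9 (k ^ 2) {{_}} {{m^n≢0 k 2}}

-- Advancing n by one changes the right-hand numerator by exactly 9k²(n+1)P_{k,n+1},
-- a polynomial identity once the recurrence is substituted for P_{k,n+4}; so the
-- numerator equals 9k² times the sum, by induction on n.
module Submission where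

open import Defs
open import Data.Nat as ℕ using (ℕ; suc; NonZero)
open import Data.Nat.ListAction.Properties using (sum-++)
import Data.Nat.Properties as ℕ
open import Data.Integer using (ℤ; +_; -_; _+_; _-_; _*_; _^_)
open import Data.Integer.Properties using (pos-+; pos-*; *-identityʳ; *-zeroʳ; *-comm; *-distribˡ-+)
open import Data.Integer.Solver using (module +-*-Solver)
open import Data.Rational using (_/_)
open import Data.Rational.Properties using (fromℚᵘ-cong)
open import Data.Rational.Unnormalised using (mkℚᵘ; *≡*)
open import Data.List using ([]; _∷_; _∷ʳ_; map; upTo)
open import Data.List.Properties using (map-++; upTo-∷ʳ)
open import Data.Nat.ListAction using (sum)
open import Relation.Binary.PropositionalEquality
  using (_≡_; refl; sym; trans; cong; cong₂; module ≡-Reasoning)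
open +-*-Solver using (Polynomial; solve; con; _:=_; _:+_; _:-_; _:*_; _:^_; :-_)

open ≡-Reasoning

-- Cross-multiplication, done on unnormalised fractions since `fromℚᵘ` respects their equivalence.
-- `mkℚᵘ` stores the denominator minus one, hence the `0` and the match on `suc r`.
/-expand : ∀ m p q → .{{_ : NonZero q}} → p ≡ + q * m → m / 1 ≡ p / q
/-expand m p (suc r) p≡qm = fromℚᵘ-cong {mkℚᵘ m 0} {mkℚᵘ p r} (*≡* (begin
  m * + suc r  ≡⟨ *-comm m (+ suc r) ⟩
  + suc r * m  ≡⟨ p≡qm ⟨
  p            ≡⟨ *-identityʳ p ⟨
  p * + 1      ∎))

sum-map-upTo-suc : ∀ (f : ℕ → ℕ) n →
  sum (map f (upTo (suc n))) ≡ sum (map f (upTo n)) ℕ.+ f n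
sum-map-upTo-suc f n = begin
  sum (map f (upTo (suc n)))             ≡⟨ cong (λ is → sum (map f is)) (upTo-∷ʳ n) ⟨
  sum (map f (upTo n ∷ʳ n))              ≡⟨ cong sum (map-++ f (upTo n) (n ∷ [])) ⟩
  sum (map f (upTo n) ∷ʳ f n)            ≡⟨ sum-++ (map f (upTo n)) (f n ∷ []) ⟩
  sum (map f (upTo n)) ℕ.+ (f n ℕ.+ 0)   ≡⟨ cong (sum (map f (upTo n)) ℕ.+_) (ℕ.+-identityʳ (f n)) ⟩
  sum (map f (upTo n)) ℕ.+ f n           ∎

weightedSum : ℕ → ℕ → ℕ
weightedSum k n = sum (map (λ i → i ℕ.* P k i) (upTo (suc n)))

pos-9*k^2 : ∀ k → + (9 ℕ.* k ℕ.^ 2) ≡ + 9 * (+ k) ^ 2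
pos-9*k^2 k = begin
  + (9 ℕ.* k ℕ.^ 2)        ≡⟨ pos-* 9 (k ℕ.^ 2) ⟩
  + 9 * + (k ℕ.^ 2)        ≡⟨ cong (+ 9 *_) (pos-* k (k ℕ.* 1)) ⟩
  + 9 * (+ k * + (k ℕ.* 1)) ≡⟨ cong (λ i → + 9 * (+ k * i)) (pos-* k 1) ⟩
  + 9 * (+ k) ^ 2          ∎

pos-P-rec : ∀ k n →
  + P k (3 ℕ.+ n) ≡ + 2 * + k * + P k (2 ℕ.+ n) + + k * + P k (1 ℕ.+ n) + + P k n
pos-P-rec k n = begin
  + (2 ℕ.* k ℕ.* z ℕ.+ k ℕ.* y ℕ.+ x)      ≡⟨ pos-+ (2 ℕ.* k ℕ.* z ℕ.+ k ℕ.* y) x ⟩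
  + (2 ℕ.* k ℕ.* z ℕ.+ k ℕ.* y) + + x      ≡⟨ cong (_+ + x) (pos-+ (2 ℕ.* k ℕ.* z) (k ℕ.* y)) ⟩
  + (2 ℕ.* k ℕ.* z) + + (k ℕ.* y) + + x    ≡⟨ cong (_+ + x) (cong₂ _+_ 2kz (pos-* k y)) ⟩
  + 2 * + k * + z + + k * + y + + x        ∎
  where
  x = P k n
  y = P k (1 ℕ.+ n)
  z = P k (2 ℕ.+ n)
  2kz : + (2 ℕ.* k ℕ.* z) ≡ + 2 * + k * + z
  2kz = trans (pos-* (2 ℕ.* k) z) (cong (_* + z) (pos-* 2 k))

-- The sequence values are free variables: `z`, `y`, `x` stand for the terms at n+3, n+2, n+1. Base
-- case and step thus become polynomial identities for the ring solver, with `numeratorPoly` as the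
-- syntactic twin.
numerator : (K N z y x : ℤ) → ℤ
numerator K N z y x =
  ((+ 3) * K * N + ((+ 5) * K - (+ 3))) * z
    + (((+ 3) * K - (+ 6) * K ^ 2) * N + ((- (+ 10)) * K ^ 2 + (+ 8) * K - (+ 3))) * y
    + (((+ 3) * K - (+ 9) * K ^ 2) * N + ((- (+ 9)) * K ^ 2 + (+ 8) * K - (+ 3))) * x
    + (K + (+ 3))

numeratorPoly : ∀ {m} (K N z y x : Polynomial m) → Polynomial m
numeratorPoly K N z y x =
  (con (+ 3) :* K :* N :+ (con (+ 5) :* K :- con (+ 3))) :* z
    :+ ((con (+ 3) :* K :- con (+ 6) :* K :^ 2) :* N :+ ((:- con (+ 10)) :* K :^ 2 :+ con (+ 8) :* K :- con (+ 3))) :* y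
    :+ ((con (+ 3) :* K :- con (+ 9) :* K :^ 2) :* N :+ ((:- con (+ 9)) :* K :^ 2 :+ con (+ 8) :* K :- con (+ 3))) :* x
    :+ (K :+ con (+ 3))

-- At n = 0 the three sequence terms add up to -K - 3, which the constant d = K + 3 cancels.
numerator-zero : ∀ K →
  numerator K (+ 0) (+ 2 * K * (+ 2 * K) + K * + 1 + + 0) (+ 2 * K) (+ 1) ≡ + 0
numerator-zero = solve 1 (λ K →
  numeratorPoly K (con (+ 0))
    (con (+ 2) :* K :* (con (+ 2) :* K) :+ K :* con (+ 1) :+ con (+ 0)) (con (+ 2) :* K) (con (+ 1))
    := con (+ 0)) refl

-- Write A, B, C for the coefficients of `z`, `y`, `x`. Comparing coefficients on both sides leaves
-- 2K A(N+1) + B(N+1) = A(N), K A(N+1) + C(N+1) = B(N) and A(N+1) = C(N) + 9K²(N+1).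
numerator-suc : ∀ K N z y x →
  numerator K (+ 1 + N) (+ 2 * K * z + K * y + x) z y
    ≡ numerator K N z y x + + 9 * K ^ 2 * ((+ 1 + N) * x)
numerator-suc = solve 5 (λ K N z y x →
  numeratorPoly K (con (+ 1) :+ N) (con (+ 2) :* K :* z :+ K :* y :+ x) z y
    := numeratorPoly K N z y x :+ con (+ 9) :* K :^ 2 :* ((con (+ 1) :+ N) :* x)) refl

numerator≡9k²*weightedSum : ∀ k n →
  numerator (+ k) (+ n) (+ P k (3 ℕ.+ n)) (+ P k (2 ℕ.+ n)) (+ P k (1 ℕ.+ n))
    ≡ + 9 * (+ k) ^ 2 * + weightedSum k n
numerator≡9k²*weightedSum k 0 = begin
  numerator K (+ 0) (+ P k 3) (+ P k 2) (+ 1)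
    ≡⟨ cong (λ z → numerator K (+ 0) z (+ P k 2) (+ 1)) (pos-P-rec k 0) ⟩
  numerator K (+ 0) (+ 2 * K * + P k 2 + K * + 1 + + 0) (+ P k 2) (+ 1)
    ≡⟨ cong (λ y → numerator K (+ 0) (+ 2 * K * y + K * + 1 + + 0) y (+ 1)) (pos-* 2 k) ⟩
  numerator K (+ 0) (+ 2 * K * (+ 2 * K) + K * + 1 + + 0) (+ 2 * K) (+ 1)
    ≡⟨ numerator-zero K ⟩
  + 0
    -- `weightedSum k 0` computes to 0, its only summand being 0 times `P k 0`.
    ≡⟨ *-zeroʳ (+ 9 * K ^ 2) ⟨
  + 9 * K ^ 2 * + 0 ∎
  where K = + k
numerator≡9k²*weightedSum k (suc n) = begin
  numerator K (+ suc n) (+ P k (4 ℕ.+ n)) z y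
    ≡⟨ cong (λ w → numerator K (+ suc n) w z y) (pos-P-rec k (1 ℕ.+ n)) ⟩
  numerator K (+ suc n) (+ 2 * K * z + K * y + x) z y
    ≡⟨ numerator-suc K (+ n) z y x ⟩
  numerator K (+ n) z y x + + 9 * K ^ 2 * (+ suc n * x)
    ≡⟨ cong (_+ + 9 * K ^ 2 * (+ suc n * x)) (numerator≡9k²*weightedSum k n) ⟩
  + 9 * K ^ 2 * + weightedSum k n + + 9 * K ^ 2 * (+ suc n * x)
    ≡⟨ *-distribˡ-+ (+ 9 * K ^ 2) (+ weightedSum k n) (+ suc n * x) ⟨
  + 9 * K ^ 2 * (+ weightedSum k n + + suc n * x)
    ≡⟨ cong (λ i → + 9 * K ^ 2 * (+ weightedSum k n + i)) (pos-* (suc n) (P k (suc n))) ⟨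
  + 9 * K ^ 2 * (+ weightedSum k n + + (suc n ℕ.* P k (suc n)))
    ≡⟨ cong (+ 9 * K ^ 2 *_) (pos-+ (weightedSum k n) (suc n ℕ.* P k (suc n))) ⟨
  + 9 * K ^ 2 * + (weightedSum k n ℕ.+ suc n ℕ.* P k (suc n))
    -- Taken at `suc n` because `weightedSum k n` already runs over `upTo (suc n)`, that is, 0 to n
    -- inclusive.
    ≡⟨ cong (λ s → + 9 * K ^ 2 * + s) (sum-map-upTo-suc (λ i → i ℕ.* P k i) (suc n)) ⟨
  + 9 * K ^ 2 * + weightedSum k (suc n) ∎
  where
  K = + k
  x = + P k (1 ℕ.+ n)
  y = + P k (2 ℕ.+ n)
  z = + P k (3 ℕ.+ n)

proposition3 : (k : ℕ) → .{{_ : NonZero k}} → (n : ℕ) →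
  let K  = + k
      N  = + n
      a₁ = (+ 3) * K
      a₂ = (+ 5) * K - (+ 3)
      b₁ = (+ 3) * K - (+ 6) * K ^ 2
      b₂ = (- (+ 10)) * K ^ 2 + (+ 8) * K - (+ 3)
      c₁ = (+ 3) * K - (+ 9) * K ^ 2
      c₂ = (- (+ 9)) * K ^ 2 + (+ 8) * K - (+ 3)
      d  = K + (+ 3)
      numerator =
        (a₁ * N + a₂) * (+ P k (n ℕ.+ 3))
          + (b₁ * N + b₂) * (+ P k (n ℕ.+ 2))
          + (c₁ * N + c₂) * (+ P k (n ℕ.+ 1))
          + d
  in
  (+ sum (map (λ i → i ℕ.* P k i) (upTo (suc n)))) / 1
    ≡ (numerator / (9 ℕ.* k ℕ.^ 2)) {{9*k^2≢0 k}}
proposition3 k n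
  -- The indices become `3 ℕ.+ n` and so on, which reduce to the successor form that the recursion
  -- of `P` matches on.
  rewrite ℕ.+-comm n 3 | ℕ.+-comm n 2 | ℕ.+-comm n 1
  = /-expand (+ weightedSum k n) _ (9 ℕ.* k ℕ.^ 2) {{9*k^2≢0 k}}
      (trans (numerator≡9k²*weightedSum k n)
             (cong (_* + weightedSum k n) (sym (pos-9*k^2 k))))
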